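{- The following two statements are equivalent: (1) For all $n\ge1$, every infinite sequence of positive integers $x_1<x_2<\cdots$ with $x_{i+1}-x_i\le n$ for all $i$ contains a double 3-term arithmetic progression. (2) For all $n\ge1$ and all $m\in\mathbb{N}$, every infinite sequence of positive integers $x_1<x_2<\cdots$ with $x_{i+1}-x_i\le n$ for all $i$ contains a double 3-term arithmetic progression $x_i,x_j,x_k$ (with $i<j<k$) such that $j-i=k-j\ge m$.
   Context: An increasing sequence of positive integers $x_1<x_2<\cdots$ contains a double 3-term arithmetic progression $x_i,x_j,x_k$ if $i<j<k$, $i+k=2j$ and $x_i+x_k=2x_j$. -}

module Defs where

open import Data.Nat using (ℕ; suc; _+_; _*_; _∸_; _≤_; _<_; _≥_)
open import Data.Product using (_×_; ∃-syntax)
open import Relation.Binary.PropositionalEquality using (_≡_)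

-- A sequence x₁ < x₂ < ⋯ is a function on ℕ with x i standing for xᵢ₊₁.
-- The index conditions below (i < j < k, i + k = 2j, index differences)
-- are invariant under this shift.
record IncreasingSequence : Set where
  field
    x          : ℕ → ℕ
    positive   : ∀ i → 0 < x i
    increasing : ∀ i → x i < x (suc i)

open IncreasingSequence public

-- Since the sequence is increasing, ∸ is never truncated here.
GapsBoundedBy : ℕ → IncreasingSequence → Set
GapsBoundedBy n s = ∀ i → x s (suc i) ∸ x s i ≤ n

IsDouble3AP : IncreasingSequence → ℕ → ℕ → ℕ → Set
IsDouble3AP s i j k =
  i < j × j < k × i + k ≡ 2 * j × x s i + x s k ≡ 2 * x s j

ContainsDouble3AP : IncreasingSequence → Set
ContainsDouble3AP s = ∃[ i ] ∃[ j ] ∃[ k ] IsDouble3AP s i j k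

ContainsDouble3APWithStep≥ : ℕ → IncreasingSequence → Set
ContainsDouble3APWithStep≥ m s =
  ∃[ i ] ∃[ j ] ∃[ k ]
    (IsDouble3AP s i j k × j ∸ i ≡ k ∸ j × k ∸ j ≥ m)

{-# OPTIONS --safe #-}

-- A double 3-term progression of the thinned sequence i ↦ x (i * M) is one of
-- x whose index step is a positive multiple of M, and thinning by M
-- multiplies the gap bound by at most M.
module Submission where

open import Data.Nat using (ℕ; zero; suc; _+_; _*_; _∸_; _≤_; _<_; _≥_; NonZero; >-nonZero)
open import Data.Nat.Properties
open import Data.Product using (_,_)
open import Function.Bundles using (_⇔_; mk⇔)
open import Relation.Binary.PropositionalEquality using (_≡_; sym; trans; cong; module ≡-Reasoning)
open import Defs

-- Only (1) ⇒ (2) has content. Since (1) covers all gap bounds at once, it applies to the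
-- subsequence of every `M`-th term, whose gaps are at most `M * n`. A progression with index step d
-- there has the same values in the original sequence and index step d * M, which is at least `M`
-- because d is positive.

increasing-+ : (s : IncreasingSequence) (m a : ℕ) .{{_ : NonZero m}} → x s a < x s (m + a)
increasing-+ s (suc zero)      a = increasing s a
increasing-+ s (suc m@(suc _)) a = <-trans (increasing-+ s m a) (increasing s (m + a))

gap-bound : (n : ℕ) (s : IncreasingSequence) → GapsBoundedBy n s →
  (m a : ℕ) → x s (m + a) ≤ m * n + x s a
gap-bound n s gaps zero    a = ≤-refl
gap-bound n s gaps (suc m) a = begin
  x s (suc m + a)          ≤⟨ m≤n+m∸n (x s (suc m + a)) (x s (m + a)) ⟩
  x s (m + a) + (x s (suc m + a) ∸ x s (m + a))
                           ≤⟨ +-monoʳ-≤ (x s (m + a)) (gaps (m + a)) ⟩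
  x s (m + a) + n          ≡⟨ +-comm (x s (m + a)) n ⟩
  n + x s (m + a)          ≤⟨ +-monoʳ-≤ n (gap-bound n s gaps m a) ⟩
  n + (m * n + x s a)      ≡⟨ sym (+-assoc n (m * n) (x s a)) ⟩
  suc m * n + x s a        ∎
  where open ≤-Reasoning

thin : (M : ℕ) .{{_ : NonZero M}} → IncreasingSequence → IncreasingSequence
thin M s = record
  { x          = λ i → x s (i * M)
  ; positive   = λ i → positive s (i * M)
  -- `suc i * M` reduces to `M + i * M`, hence the offset form `m + a` of the lemmas above.
  ; increasing = λ i → increasing-+ s M (i * M)
  }

thin-gaps : (n M : ℕ) .{{_ : NonZero M}} (s : IncreasingSequence) →
  GapsBoundedBy n s → GapsBoundedBy (M * n) (thin M s)
thin-gaps n M s gaps i = m≤n+o⇒m∸n≤o (x s (M + i * M)) (x s (i * M))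
  (≤-trans (gap-bound n s gaps M (i * M)) (≤-reflexive (+-comm (M * n) (x s (i * M)))))

-- Adding `i + j` to the two differences gives `2 * j` and `i + k` respectively, so it can be
-- cancelled.
equal-steps : ∀ {i j k} → i < j → j < k → i + k ≡ 2 * j → j ∸ i ≡ k ∸ j
equal-steps {i} {j} {k} i<j j<k i+k≡2j = +-cancelˡ-≡ (i + j) (j ∸ i) (k ∸ j) (begin
  i + j + (j ∸ i)    ≡⟨ cong (_+ (j ∸ i)) (+-comm i j) ⟩
  j + i + (j ∸ i)    ≡⟨ +-assoc j i (j ∸ i) ⟩
  j + (i + (j ∸ i))  ≡⟨ cong (j +_) (m+[n∸m]≡n (<⇒≤ i<j)) ⟩
  j + j              ≡⟨ cong (j +_) (sym (+-identityʳ j)) ⟩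
  2 * j              ≡⟨ sym i+k≡2j ⟩
  i + k              ≡⟨ cong (i +_) (sym (m+[n∸m]≡n (<⇒≤ j<k))) ⟩
  i + (j + (k ∸ j))  ≡⟨ sym (+-assoc i j (k ∸ j)) ⟩
  i + j + (k ∸ j)    ∎)
  where open ≡-Reasoning

thin-double3AP : (M : ℕ) .{{_ : NonZero M}} (s : IncreasingSequence) →
  ContainsDouble3AP (thin M s) → ContainsDouble3APWithStep≥ M s
thin-double3AP M s (i , j , k , i<j , j<k , i+k≡2j , xs) =
  i * M , j * M , k * M , (iM<jM , jM<kM , iM+kM≡2jM , xs) ,
  equal-steps iM<jM jM<kM iM+kM≡2jM ,
  -- The new step is `(k ∸ j) * M`, and `k ∸ j` is positive.
  ≤-trans (m≤n*m M (k ∸ j) {{>-nonZero (m<n⇒0<n∸m j<k)}})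
          (≤-reflexive (*-distribʳ-∸ M k j))
  where
  iM<jM = *-monoˡ-< M i<j
  jM<kM = *-monoˡ-< M j<k
  iM+kM≡2jM : i * M + k * M ≡ 2 * (j * M)
  iM+kM≡2jM = trans (sym (*-distribʳ-+ M i k)) (trans (cong (_* M) i+k≡2j) (*-assoc 2 j M))

step≥-weaken : ∀ {l m} (s : IncreasingSequence) → l ≤ m →
  ContainsDouble3APWithStep≥ m s → ContainsDouble3APWithStep≥ l s
step≥-weaken s l≤m (i , j , k , ap , eq , m≤) = i , j , k , ap , eq , ≤-trans l≤m m≤

forget-step : ∀ {m} (s : IncreasingSequence) →
  ContainsDouble3APWithStep≥ m s → ContainsDouble3AP s
forget-step s (i , j , k , ap , _) = i , j , k , ap

theorem5 : (∀ (n : ℕ) → n ≥ 1 → (s : IncreasingSequence) → GapsBoundedBy n s →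
    ContainsDouble3AP s)
    ⇔
    (∀ (n : ℕ) → n ≥ 1 → (m : ℕ) → (s : IncreasingSequence) → GapsBoundedBy n s →
    ContainsDouble3APWithStep≥ m s)
theorem5 = mk⇔
  -- Thinning by `suc m` instead of `m` keeps the factor nonzero when `m` is 0; the surplus is then
  -- weakened away.
  (λ h n n≥1 m s gaps → step≥-weaken s (n≤1+n m)
    (thin-double3AP (suc m) s
      (h (suc m * n) (≤-trans n≥1 (m≤m+n n (m * n))) (thin (suc m) s)
        (thin-gaps n (suc m) s gaps))))
  -- With `m` equal to 0 the step condition is vacuous.
  (λ h n n≥1 s gaps → forget-step s (h n n≥1 0 s gaps))
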